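{- Fix integers $k,l\geq 2$, $m\ge 1$, $a\in\mathbb{Z}$, a polynomial $R(x_1,\dots,x_m)\in\mathbb{Z}[x_1,\dots,x_m]$, and integers $0\le s\le r$ with $r\ge1$. Let $P(x)=(x-a)^e\prod_{j=1}^t P_j(x)^{e_j}\in\mathbb{Z}[x]$ with $e\geq1$, $e_j\ge1$, where $P_1,\dots,P_t\in\mathbb{Z}[x]$ are distinct irreducible polynomials. Then the equation $$P(x)=\prod_{i=1}^s n_i!\cdot\prod_{i=s+1}^r n_i!!$$ has only finitely many solutions $(n_1,\dots,n_r,x)$ with $n_1,\dots,n_r$ positive integers and $x\in S_{a,R}$.
   Context: For a positive integer $x=\prod_{i\in I}p_i^{\alpha_i}$, $K(x)=\max_{i\in I}\alpha_i$ (with $K(1)=0$) and $\omega(x)=|I|$. $\mathcal{F}_k=\{x\in\mathbb{N}: K(x)<k\}$, $\mathcal{P}_l=\{x\in\mathbb{N}:\omega(x)<l\}$, and $\mathcal{F}_k\mathcal{P}_l=\{yz: y\in\mathcal{F}_k, z\in\mathcal{P}_l\}$. $S_{a,R}=\{x_1\cdots x_m\cdot R(x_1,\dots,x_m)+a : x_1,\dots,x_m\in\mathcal{F}_k\mathcal{P}_l\}$. $n!!$ is the double factorial. -}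

module Defs where

open import Algebra.Bundles.Raw using (RawSemiring)
import Algebra.Definitions.RawSemiring as RawSemiringDefs
open import Data.Integer.Base as ℤ using (ℤ; +_)
open import Data.List.Base as List using (List; []; _∷_; length; filter; deduplicate)
open import Data.List.Extrema.Nat using (max)
open import Data.List.Membership.Propositional using () renaming (_∈_ to _∈ˡ_)
open import Data.Nat.Base as ℕ using (ℕ; zero; suc; NonZero; _<_; _!)
open import Data.Nat.ListAction using (product)
open import Data.Nat.Primality.Factorisation using (factors; factorise)
open import Data.Nat.Properties using (_≟_)
open import Data.Product.Base using (Σ; ∃; ∃-syntax; _×_; _,_)
open import Data.Vec.Base as Vec using (Vec; toList)
open import Data.Vec.Relation.Unary.All using (All)
open import Level using (0ℓ)
open import Relation.Binary.PropositionalEquality.Core using (_≡_)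
open import Relation.Unary using (Pred; _⊆_)

-- Classically the same as finiteness of Q: a subset of a finite set is finite.
Finite : {A : Set} → Pred A 0ℓ → Set
Finite {A} Q = ∃[ xs ] Q ⊆ (_∈ˡ xs)

-- ℤ[X]: coefficient lists, constant term first.  Trailing zeros are allowed,
-- so equality of polynomials is _≈ᵖ_, not _≡_.

Poly : Set
Poly = List ℤ

coeff : Poly → ℕ → ℤ
coeff []      _       = ℤ.0ℤ
coeff (c ∷ p) zero    = c
coeff (c ∷ p) (suc n) = coeff p n

infix  4 _≈ᵖ_
infixl 6 _+ᵖ_
infixl 7 _*ᵖ_

_≈ᵖ_ : Poly → Poly → Set
p ≈ᵖ q = ∀ n → coeff p n ≡ coeff q n

_+ᵖ_ : Poly → Poly → Poly
[]      +ᵖ q       = q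
(c ∷ p) +ᵖ []      = c ∷ p
(c ∷ p) +ᵖ (d ∷ q) = (c ℤ.+ d) ∷ (p +ᵖ q)

_*ᵖ_ : Poly → Poly → Poly
[]      *ᵖ q = []
(c ∷ p) *ᵖ q = List.map (c ℤ.*_) q +ᵖ (ℤ.0ℤ ∷ (p *ᵖ q))

ℤ[X] : RawSemiring 0ℓ 0ℓ
ℤ[X] = record
  { Carrier = Poly
  ; _≈_     = _≈ᵖ_
  ; _+_     = _+ᵖ_
  ; _*_     = _*ᵖ_
  ; 0#      = []
  ; 1#      = ℤ.1ℤ ∷ []
  }

open RawSemiringDefs ℤ[X] public
  using (Irreducible) renaming (_^_ to _^ᵖ_; product to ∏ᵖ)

X-_ : ℤ → Poly
X- a = (ℤ.- a) ∷ ℤ.1ℤ ∷ []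

⟦_⟧ : Poly → ℤ → ℤ
⟦ []    ⟧ x = ℤ.0ℤ
⟦ c ∷ p ⟧ x = c ℤ.+ x ℤ.* ⟦ p ⟧ x

-- ℤ[x₁,…,xₘ]: the list of pairs (c , (α₁,…,αₘ)) stands for the sum of the
-- monomials c x₁^α₁ ⋯ xₘ^αₘ.
MvPoly : ℕ → Set
MvPoly m = List (ℤ × Vec ℕ m)

⟦_⟧ᵐ : ∀ {m} → MvPoly m → Vec ℤ m → ℤ
⟦ []           ⟧ᵐ xs = ℤ.0ℤ
⟦ (c , α) ∷ R ⟧ᵐ xs =
  c ℤ.* Vec.foldr _ ℤ._*_ ℤ.1ℤ (Vec.zipWith ℤ._^_ xs α) ℤ.+ ⟦ R ⟧ᵐ xs

primeFactors : (x : ℕ) → .{{NonZero x}} → List ℕ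
primeFactors x = factors (factorise x)

-- The exponent of p in x, i.e. the multiplicity of p in the list of prime factors.
exponent : ℕ → (x : ℕ) → .{{NonZero x}} → ℕ
exponent p x = length (filter (p ≟_) (primeFactors x))

K : (x : ℕ) → .{{NonZero x}} → ℕ
K x = max 0 (List.map (λ p → exponent p x) (primeFactors x))

ω : (x : ℕ) → .{{NonZero x}} → ℕ
ω x = length (deduplicate _≟_ (primeFactors x))

𝓕 : ℕ → Pred ℕ 0ℓ
𝓕 k x = Σ (NonZero x) λ x≢0 → K x {{x≢0}} < k

𝓟 : ℕ → Pred ℕ 0ℓ
𝓟 l x = Σ (NonZero x) λ x≢0 → ω x {{x≢0}} < l

𝓕𝓟 : ℕ → ℕ → Pred ℕ 0ℓ
𝓕𝓟 k l x = ∃[ y ] ∃[ z ] (𝓕 k y × 𝓟 l z × x ≡ y ℕ.* z)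

S : (k l : ℕ) {m : ℕ} → ℤ → MvPoly m → Pred ℤ 0ℓ
S k l {m} a R x =
  Σ (Vec ℕ m) λ xs →
    All (𝓕𝓟 k l) xs ×
    x ≡ + product (toList xs) ℤ.* ⟦ R ⟧ᵐ (Vec.map +_ xs) ℤ.+ a

infix 9 _!!

_!! : ℕ → ℕ
zero          !! = 1
suc zero      !! = 1
suc (suc n)   !! = suc (suc n) ℕ.* n !!

factorials : (s : ℕ) {r : ℕ} → Vec ℕ r → ℕ
factorials s ns =
  product (List.map _!  (List.take s (toList ns))) ℕ.*
  product (List.map _!! (List.drop s (toList ns)))

{-# OPTIONS --safe #-}
module Submission where

-- Let n = max nᵢ and let N be the right-hand side.  If x = x₁⋯xₘ R(x₁,…,xₘ) + a
-- is a solution, then every xᵢ divides x − a, hence P(x) = N, hence (n!)^r, so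
-- the prime factors of xᵢ are at most n.  A k-free number with such prime
-- factors is at most the k-th power of the product of the primes up to n, which
-- is at most 16^n; and a prime power dividing (n!)^r is at most 4^(nr), which
-- bounds numbers with fewer than l prime factors.  So the xᵢ, and therefore
-- |x| and |P(x)| = N, are at most exponential in n.  But N ≥ n!! grows faster
-- than any exponential, so n is bounded, and then so is x.

open import Defs
open import Algebra.Properties.CommutativeSemigroup using (x∙yz≈y∙xz)
open import Data.Fin.Base using (Fin)
open import Data.Integer.Base as ℤ using (ℤ; +_; -[1+_]; ∣_∣)
import Data.Integer.Properties as ℤ
import Data.Integer.Tactic.RingSolver as ℤ-Solver
open import Data.List.Base as List using (List; []; _∷_; length; filter; deduplicate; _++_; take; drop; upTo; cartesianProduct; cartesianProductWith)
open import Data.List.Extrema.Nat using (max; xs≤max; argmax-sel)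
open import Data.List.Membership.Propositional using (_∈_)
open import Data.List.Membership.Propositional.Properties using (∈-filter⁻; ∈-deduplicate⁺; ∈-deduplicate⁻; ∈-map⁺; ∈-++⁺ˡ; ∈-++⁺ʳ; ∈-++⁻; ∈-upTo⁺; ∈-cartesianProduct⁺; ∈-cartesianProductWith⁺)
open import Data.List.Properties using (length-++; take++drop≡id)
import Data.List.Relation.Binary.Sublist.Propositional.Properties as Sublist
open import Data.List.Relation.Binary.Subset.Propositional using (_⊆_)
open import Data.List.Relation.Unary.All as List∀ using ([]; _∷_) renaming (All to List∀)
import Data.List.Relation.Unary.All.Properties as List∀
open import Data.List.Relation.Unary.AllPairs using (_∷_)
open import Data.List.Relation.Unary.Any using (here; there)
open import Data.List.Relation.Unary.Unique.DecPropositional.Properties using (deduplicate-!)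
open import Data.List.Relation.Unary.Unique.Propositional using (Unique)
open import Data.List.Relation.Unary.Unique.Propositional.Properties as Unique using (Unique[x∷xs]⇒x∉xs)
open import Data.Nat.Base
open import Data.Nat.Combinatorics using (_C_; nCk≡n!/k![n-k]!; k![n∸k]!∣n!; nCk+nC[k+1]≡[n+1]C[k+1])
open import Data.Nat.Divisibility
open import Data.Nat.DivMod using (m≡m%n+[m/n]*n; m%n<n; m/n<m; m/n*n≤m; m/n*n≡m)
open import Data.Nat.Induction using (<-rec)
open import Data.Nat.ListAction using (product)
open import Data.Nat.ListAction.Properties using (∈⇒∣product; product≢0)
open import Data.Nat.Primality using (Prime; prime⇒nonZero; prime⇒nonTrivial; euclidsLemma)
open import Data.Nat.Primality.Factorisation using (factorise; factorisationHasAllPrimeFactors; module PrimeFactorisation)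
open import Data.Nat.Properties
open import Data.Nat.Tactic.RingSolver using (solve-∀)
open import Data.Product.Base using (∃-syntax; _×_; _,_; proj₁; proj₂)
open import Data.Sum.Base using (inj₁; inj₂)
open import Data.Vec.Base as Vec using (Vec; []; _∷_; toList)
open import Data.Vec.Properties using (length-toList)
open import Data.Vec.Relation.Unary.All as Vec∀ using (All; []; _∷_)
import Data.Vec.Relation.Unary.All.Properties as Vec∀
open import Function.Base using (_∘_; case_of_)
open import Relation.Binary.PropositionalEquality
open import Relation.Nullary.Decidable using (yes; no; ¬?)
open import Relation.Nullary.Negation using (¬_; contradiction)
open import Relation.Unary using (Pred; Decidable)

private
  variable
    p : ℕ

-- Powers, and prime divisors of factorials

^-distribʳ-* : ∀ a b n → (a * b) ^ n ≡ a ^ n * b ^ n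
^-distribʳ-* a b zero    = refl
^-distribʳ-* a b (suc n) = begin
  a * b * (a * b) ^ n       ≡⟨ cong (a * b *_) (^-distribʳ-* a b n) ⟩
  a * b * (a ^ n * b ^ n)   ≡⟨ [m*n]*[o*p]≡[m*o]*[n*p] a b (a ^ n) (b ^ n) ⟩
  a * a ^ n * (b * b ^ n)   ∎
  where open ≡-Reasoning

prime∣!⇒≤ : Prime p → ∀ n → p ∣ n ! → p ≤ n
prime∣!⇒≤ pr zero    p∣1 = contradiction (∣1⇒≡1 p∣1) (nonTrivial⇒≢1 {{prime⇒nonTrivial pr}})
prime∣!⇒≤ pr (suc n) p∣  with euclidsLemma (suc n) (n !) pr p∣
... | inj₁ p∣1+n = ∣⇒≤ p∣1+n
... | inj₂ p∣n!  = m≤n⇒m≤1+n (prime∣!⇒≤ pr n p∣n!)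

prime∣^⇒∣ : Prime p → ∀ a n → p ∣ a ^ n → p ∣ a
prime∣^⇒∣ pr a zero    p∣1 = contradiction (∣1⇒≡1 p∣1) (nonTrivial⇒≢1 {{prime⇒nonTrivial pr}})
prime∣^⇒∣ pr a (suc n) p∣  with euclidsLemma a (a ^ n) pr p∣
... | inj₁ p∣a  = p∣a
... | inj₂ p∣aⁿ = prime∣^⇒∣ pr a n p∣aⁿ

-- The exponential bound on products of distinct primes

nCk≤2^n : ∀ n k → n C k ≤ 2 ^ n
nCk≤2^n zero    zero    = ≤-refl
nCk≤2^n zero    (suc k) = z≤n
nCk≤2^n (suc n) zero    = m^n>0 2 (suc n)
nCk≤2^n (suc n) (suc k) = begin
  suc n C suc k       ≡⟨ nCk+nC[k+1]≡[n+1]C[k+1] n k ⟨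
  n C k + n C suc k   ≤⟨ +-mono-≤ (nCk≤2^n n k) (nCk≤2^n n (suc k)) ⟩
  2 ^ n + 2 ^ n       ≡⟨ cong (λ t → 2 ^ n + t) (+-identityʳ (2 ^ n)) ⟨
  2 ^ suc n           ∎
  where open ≤-Reasoning

nCk*k!*[n∸k]!≡n! : ∀ {n k} → k ≤ n → (n C k) * (k ! * (n ∸ k) !) ≡ n !
nCk*k!*[n∸k]!≡n! {n} {k} k≤n = trans
  (cong (_* (k ! * (n ∸ k) !)) (nCk≡n!/k![n-k]! k≤n))
  (m/n*n≡m {{k !* (n ∸ k) !≢0}} (k![n∸k]!∣n! k≤n))

-- `p` divides `n !`, but neither `k !` nor `(n ∸ k) !`, whose factors are all below `p`; so it must
-- divide the remaining factor, the binomial coefficient.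
prime∣nCk : ∀ {n k} → Prime p → k ≤ n → p ≤ n → k < p → n ∸ k < p → p ∣ n C k
prime∣nCk {p} {n} {k} pr k≤n p≤n k<p n∸k<p
  with euclidsLemma (n C k) (k ! * (n ∸ k) !) pr (subst (p ∣_) (sym (nCk*k!*[n∸k]!≡n! k≤n)) p∣n!)
  where
  p∣n! : p ∣ n !
  p∣n! = ∣-trans (m∣m! p {{prime⇒nonZero pr}}) (m≤n⇒m!∣n! p≤n)
    where
    m∣m! : ∀ m .{{_ : NonZero m}} → m ∣ m !
    m∣m! (suc m) = m∣m*n (m !)
... | inj₁ p∣C = p∣C
... | inj₂ p∣k!*[n∸k]! with euclidsLemma (k !) ((n ∸ k) !) pr p∣k!*[n∸k]!
...   | inj₁ p∣k!     = contradiction (prime∣!⇒≤ pr k p∣k!) (<⇒≱ k<p)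
...   | inj₂ p∣[n∸k]! = contradiction (prime∣!⇒≤ pr (n ∸ k) p∣[n∸k]!) (<⇒≱ n∸k<p)

-- By induction `n` is `q * product ps`. The next prime `p` differs from all of `ps`, so it does not
-- divide `product ps` and by Euclid's lemma divides `q`.
distinctPrimes∣⇒product∣ : ∀ {ps n} → Unique ps → List∀ Prime ps → List∀ (_∣ n) ps → product ps ∣ n
distinctPrimes∣⇒product∣ {[]}     {n} _ _ _ = 1∣ n
distinctPrimes∣⇒product∣ {p ∷ ps} {n} u@(_ ∷ u′) (pr ∷ prs) (p∣n ∷ ps∣n)
  with distinctPrimes∣⇒product∣ u′ prs ps∣n
... | divides-refl q with euclidsLemma q (product ps) pr p∣n
...   | inj₁ p∣q = *-monoˡ-∣ (product ps) p∣q
...   | inj₂ p∣Π = contradiction (factorisationHasAllPrimeFactors pr p∣Π prs) (Unique[x∷xs]⇒x∉xs u)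

product-filter : ∀ {ℓ} {P : Pred ℕ ℓ} (P? : Decidable P) xs →
                 product xs ≡ product (filter P? xs) * product (filter (¬? ∘ P?) xs)
product-filter P? []       = refl
product-filter P? (x ∷ xs) with P? x
... | yes _ = trans (cong (x *_) (product-filter P? xs)) (sym (*-assoc x _ _))
... | no  _ = trans (cong (x *_) (product-filter P? xs)) (x∙yz≈y∙xz *-commutativeSemigroup x (product (filter P? xs)) _)

-- This turns 2^n into 16^⌊n/2⌋, which is where the base 16 = 2^4 comes from. It starts at 2 because
-- ⌊1/2⌋ = 0.
2+n≤4⌊[2+n]/2⌋ : ∀ n → 2 + n ≤ 4 * ⌊ 2 + n /2⌋
2+n≤4⌊[2+n]/2⌋ 0 = s≤s (s≤s z≤n)
2+n≤4⌊[2+n]/2⌋ 1 = s≤s (s≤s (s≤s z≤n))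
2+n≤4⌊[2+n]/2⌋ (suc (suc n)) = begin
  2 + (2 + n)              ≤⟨ +-mono-≤ {2} {4} (s≤s (s≤s z≤n)) (2+n≤4⌊[2+n]/2⌋ n) ⟩
  4 + 4 * ⌊ 2 + n /2⌋      ≡⟨ *-suc 4 ⌊ 2 + n /2⌋ ⟨
  4 * ⌊ 4 + n /2⌋          ∎
  where open ≤-Reasoning

-- Induction from ⌈n/2⌉ to n: the primes in (⌈n/2⌉ , n] divide n C ⌊n/2⌋ ≤ 2^n.
product-distinctPrimes≤16^n : ∀ n {ps} → Unique ps → List∀ Prime ps → List∀ (_≤ n) ps → product ps ≤ 16 ^ n
product-distinctPrimes≤16^n = <-rec _ step
  where
  Bound : ℕ → Set
  Bound n = ∀ {ps} → Unique ps → List∀ Prime ps → List∀ (_≤ n) ps → product ps ≤ 16 ^ n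

  step : ∀ n → (∀ {m} → m < n → Bound m) → Bound n
  step n rec {[]}     _ _ _ = m^n>0 16 n
  -- For n ≤ 1 halving does not descend, as ⌈n/2⌉ = n; but then no prime is at most n.
  step 0 rec {_ ∷ _} _ (pr ∷ _) (p≤0 ∷ _) = contradiction p≤0 (<⇒≱ (<-trans z<s (nonTrivial⇒n>1 _ {{prime⇒nonTrivial pr}})))
  step 1 rec {_ ∷ _} _ (pr ∷ _) (p≤1 ∷ _) = contradiction p≤1 (<⇒≱ (nonTrivial⇒n>1 _ {{prime⇒nonTrivial pr}}))
  step n@(suc (suc n′)) rec {ps@(_ ∷ _)} u prs ps≤n = begin
    product ps                  ≡⟨ product-filter (_≤? c) ps ⟩
    product small * product big ≤⟨ *-mono-≤ small≤ big≤ ⟩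
    16 ^ c * 16 ^ h             ≡⟨ ^-distribˡ-+-* 16 c h ⟨
    16 ^ (c + h)                ≡⟨ cong (16 ^_) (trans (+-comm c h) h+c≡n) ⟩
    16 ^ n                      ∎
    where
    open ≤-Reasoning
    h = ⌊ n /2⌋
    c = ⌈ n /2⌉
    small = filter (_≤? c) ps
    big   = filter (¬? ∘ (_≤? c)) ps

    h+c≡n : h + c ≡ n
    h+c≡n = ⌊n/2⌋+⌈n/2⌉≡n n

    n∸h≡c : n ∸ h ≡ c
    n∸h≡c = trans (cong (_∸ h) (sym h+c≡n)) (m+n∸m≡n h c)

    small≤ : product small ≤ 16 ^ c
    small≤ = rec (⌈n/2⌉<n n′) (Unique.filter⁺ (_≤? c) u)
      (List∀.tabulate λ p∈ → List∀.lookup prs (proj₁ (∈-filter⁻ (_≤? c) p∈)))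
      (List∀.all-filter (_≤? c) ps)

    big∣ : product big ∣ n C h
    big∣ = distinctPrimes∣⇒product∣ (Unique.filter⁺ (¬? ∘ (_≤? c)) u)
      (List∀.tabulate λ p∈ → List∀.lookup prs (proj₁ (∈-filter⁻ (¬? ∘ (_≤? c)) p∈)))
      (List∀.tabulate λ p∈ →
        let (p∈ps , p≰c) = ∈-filter⁻ (¬? ∘ (_≤? c)) {xs = ps} p∈
            c<p = ≰⇒> p≰c
        in prime∣nCk (List∀.lookup prs p∈ps) (⌊n/2⌋≤n n) (List∀.lookup ps≤n p∈ps)
             (≤-<-trans (⌊n/2⌋≤⌈n/2⌉ n) c<p) (≤-<-trans (≤-reflexive n∸h≡c) c<p))

    nCh≢0 : NonZero (n C h)
    nCh≢0 = m*n≢0⇒m≢0 (n C h) {{subst NonZero (sym (nCk*k!*[n∸k]!≡n! (⌊n/2⌋≤n n))) (n !≢0)}}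

    big≤ : product big ≤ 16 ^ h
    big≤ = begin
      product big   ≤⟨ ∣⇒≤ {{nCh≢0}} big∣ ⟩
      n C h         ≤⟨ nCk≤2^n n h ⟩
      2 ^ n         ≤⟨ ^-monoʳ-≤ 2 (2+n≤4⌊[2+n]/2⌋ n′) ⟩
      2 ^ (4 * h)   ≡⟨ ^-*-assoc 2 4 h ⟨
      16 ^ h        ∎

-- Prime powers dividing factorials

-- The factors `p` are peeled off one at a time: Euclid's lemma places each in `a` or in `b`, where
-- it is cancelled.
prime^∣*⇒split : Prime p → ∀ v {a b} → p ^ v ∣ a * b → ∃[ i ] ∃[ j ] (i + j ≡ v × (p ^ i ∣ a) × (p ^ j ∣ b))
prime^∣*⇒split pr zero {a} {b} _ = 0 , 0 , refl , 1∣ a , 1∣ b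
prime^∣*⇒split {p} pr (suc v) {a} {b} p^∣ab
  with euclidsLemma a b pr (m*n∣⇒m∣ p (p ^ v) p^∣ab)
... | inj₁ (divides-refl a′) =
  let (i , j , i+j≡v , pⁱ∣a′ , pʲ∣b) = prime^∣*⇒split pr v {a′} {b}
        (*-cancelˡ-∣ p {{prime⇒nonZero pr}} (subst (p ^ suc v ∣_) (trans (cong (_* b) (*-comm a′ p)) (*-assoc p a′ b)) p^∣ab))
  in suc i , j , cong suc i+j≡v , subst (p ^ suc i ∣_) (*-comm p a′) (*-monoʳ-∣ p pⁱ∣a′) , pʲ∣b
... | inj₂ (divides-refl b′) =
  let (i , j , i+j≡v , pⁱ∣a , pʲ∣b′) = prime^∣*⇒split pr v {a} {b′}
        (*-cancelʳ-∣ p {{prime⇒nonZero pr}} (subst₂ _∣_ (*-comm p (p ^ v)) (sym (*-assoc a b′ p)) p^∣ab))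
  in i , suc j , trans (+-suc i j) (cong suc i+j≡v) , pⁱ∣a , subst (p ^ suc j ∣_) (*-comm p b′) (*-monoʳ-∣ p pʲ∣b′)

-- For nonzero `a` and prime `p` this bounds the `p`-part of `a`, without introducing the `p`-adic
-- valuation.
PrimePowers_∣_≤_ : ℕ → ℕ → ℕ → Set
PrimePowers p ∣ a ≤ A = ∀ v → p ^ v ∣ a → p ^ v ≤ A

primePowers-* : ∀ {a b A B} → Prime p → PrimePowers p ∣ a ≤ A → PrimePowers p ∣ b ≤ B → PrimePowers p ∣ a * b ≤ (A * B)
primePowers-* {p} {a} {b} {A} {B} pr a≤A b≤B v pᵛ∣ab with prime^∣*⇒split pr v {a} {b} pᵛ∣ab
... | i , j , refl , pⁱ∣a , pʲ∣b = subst (_≤ A * B) (sym (^-distribˡ-+-* p i j)) (*-mono-≤ (a≤A i pⁱ∣a) (b≤B j pʲ∣b))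

primePowers-1 : PrimePowers p ∣ 1 ≤ 1
primePowers-1 v pᵛ∣1 = ≤-reflexive (∣1⇒≡1 pᵛ∣1)

primePowers-^ : ∀ {a A} → Prime p → PrimePowers p ∣ a ≤ A → ∀ n → PrimePowers p ∣ a ^ n ≤ (A ^ n)
primePowers-^ pr a≤A zero    = primePowers-1
primePowers-^ pr a≤A (suc n) = primePowers-* pr a≤A (primePowers-^ pr a≤A n)

primePowers-∤ : ∀ {a} → p ∤ a → PrimePowers p ∣ a ≤ 1
primePowers-∤ p∤a zero    _     = ≤-refl
primePowers-∤ {p} p∤a (suc v) pᵛ∣a = contradiction (m*n∣⇒m∣ p (p ^ v) pᵛ∣a) p∤a

-- One step of Legendre's formula: the multiples p, 2p, ..., qp contribute p^q q!, and `u` collects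
-- the factors prime to `p`. The induction runs through the residues `r` within each block of length
-- `p`.
!-primePart : Prime p → ∀ q r → r < p → ∃[ u ] (p ∤ u × (q * p + r) ! ≡ p ^ q * q ! * u)
!-primePart pr zero zero _ = 1 , (λ p∣1 → nonTrivial⇒≢1 {{prime⇒nonTrivial pr}} (∣1⇒≡1 p∣1)) , refl
!-primePart {p} pr q (suc r) 1+r<p with !-primePart pr q r (<-trans (n<1+n r) 1+r<p)
... | u , p∤u , eq = u * (q * p + suc r) , p∤ , (begin
    (q * p + suc r) !                           ≡⟨ cong _! (+-suc (q * p) r) ⟩
    suc (q * p + r) * (q * p + r) !             ≡⟨ cong₂ _*_ (sym (+-suc (q * p) r)) eq ⟩
    (q * p + suc r) * (p ^ q * q ! * u)         ≡⟨ *-comm (q * p + suc r) _ ⟩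
    p ^ q * q ! * u * (q * p + suc r)           ≡⟨ *-assoc (p ^ q * q !) u _ ⟩
    p ^ q * q ! * (u * (q * p + suc r))         ∎)
  where
  open ≡-Reasoning
  p∤ : p ∤ u * (q * p + suc r)
  p∤ p∣ with euclidsLemma u (q * p + suc r) pr p∣
  ... | inj₁ p∣u = p∤u p∣u
  -- The residue `suc r` lies strictly between 0 and `p`.
  ... | inj₂ p∣s = >⇒∤ 1+r<p (∣m+n∣m⇒∣n p∣s (n∣m*n q))
-- Passing to the next multiple of `p`: the preceding number has residue p - 1, and the new factor
-- (q+1)p supplies one `p` and turns `q !` into `(suc q) !`.
!-primePart {p@(suc p′)} pr (suc q) zero _ with !-primePart pr q p′ (n<1+n p′)
... | u , p∤u , eq = u , p∤u , (begin
    (suc q * p + 0) !                    ≡⟨ cong _! (+-identityʳ (suc q * p)) ⟩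
    (suc q * p) * (p′ + q * p) !         ≡⟨ cong (λ t → suc q * p * t !) (+-comm p′ (q * p)) ⟩
    (suc q * p) * (q * p + p′) !         ≡⟨ cong (suc q * p *_) eq ⟩
    (suc q * p) * (p ^ q * q ! * u)      ≡⟨ rearrange (suc q) p (p ^ q) (q !) u ⟩
    p ^ suc q * (suc q) ! * u            ∎)
  where
  open ≡-Reasoning
  rearrange : ∀ a b c d e → (a * b) * (c * d * e) ≡ b * c * (a * d) * e
  rearrange = solve-∀

n<4^n : ∀ n → n < 4 ^ n
n<4^n zero    = z<s
n<4^n (suc n) = begin-strict
  suc n           <⟨ +-mono-≤-< (m^n>0 4 n) (n<4^n n) ⟩
  4 ^ n + 4 ^ n   ≤⟨ +-monoʳ-≤ (4 ^ n) (m≤m+n (4 ^ n) (2 * 4 ^ n)) ⟩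
  4 ^ suc n       ∎
  where open ≤-Reasoning

n*4≤4^n : ∀ n .{{_ : NonZero n}} → n * 4 ≤ 4 ^ n
n*4≤4^n (suc n) = ≤-trans (*-monoˡ-≤ 4 (n<4^n n)) (≤-reflexive (*-comm (4 ^ n) 4))

-- With q = ⌊n/p⌋ the p-part of n! is p^q times that of q!. By induction it is at most p^q 4^q =
-- (4p)^q, and 4p ≤ 4^p gives 4^(pq) ≤ 4^n.
primePowers∣n!≤4^n : Prime p → ∀ n → PrimePowers p ∣ n ! ≤ (4 ^ n)
primePowers∣n!≤4^n {p} pr = <-rec _ step
  where
  instance _ = prime⇒nonZero pr

  step : ∀ n → (∀ {m} → m < n → PrimePowers p ∣ m ! ≤ (4 ^ m)) → PrimePowers p ∣ n ! ≤ (4 ^ n)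
  step zero rec = primePowers-1
  step n@(suc _) rec v pᵛ∣n! = begin
    p ^ v                 ≤⟨ primePowers-* pr (primePowers-* pr p^q≤ (rec q<n)) (primePowers-∤ p∤u) v
                               (subst (p ^ v ∣_) n!≡ pᵛ∣n!) ⟩
    p ^ q * 4 ^ q * 1     ≡⟨ *-identityʳ _ ⟩
    p ^ q * 4 ^ q         ≡⟨ ^-distribʳ-* p 4 q ⟨
    (p * 4) ^ q           ≤⟨ ^-monoˡ-≤ q (n*4≤4^n p) ⟩
    (4 ^ p) ^ q           ≡⟨ ^-*-assoc 4 p q ⟩
    4 ^ (p * q)           ≤⟨ ^-monoʳ-≤ 4 (≤-trans (≤-reflexive (*-comm p q)) (m/n*n≤m n p)) ⟩
    4 ^ n                 ∎
    where
    open ≤-Reasoning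
    q = n / p
    q<n : q < n
    q<n = m/n<m n p (nonTrivial⇒n>1 p {{prime⇒nonTrivial pr}})
    part = !-primePart pr q (n % p) (m%n<n n p)
    u = proj₁ part
    p∤u = proj₁ (proj₂ part)
    n!≡ : n ! ≡ p ^ q * q ! * u
    n!≡ = trans (cong _! (trans (m≡m%n+[m/n]*n n p) (+-comm (n % p) (q * p)))) (proj₂ (proj₂ part))
    p^q≤ : PrimePowers p ∣ p ^ q ≤ (p ^ q)
    p^q≤ _ = ∣⇒≤ {{m^n≢0 p q}}

-- Divisors of powers of factorials

-- Defined for arbitrary lists so that inductions can delete entries; at `primeFactors x` it is
-- `exponent`.
multiplicity : ℕ → List ℕ → ℕ
multiplicity p xs = length (filter (p ≟_) xs)

product-constant : ∀ {d xs} → List∀ (d ≡_) xs → product xs ≡ d ^ length xs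
product-constant         []           = refl
product-constant {d = d} (refl ∷ d≡xs) = cong (d *_) (product-constant d≡xs)

product-filter≟ : ∀ d xs → product (filter (d ≟_) xs) ≡ d ^ multiplicity d xs
product-filter≟ d xs = product-constant (List∀.all-filter (d ≟_) xs)

^multiplicity∣product : ∀ d xs → d ^ multiplicity d xs ∣ product xs
^multiplicity∣product d xs = subst₂ _∣_ (product-filter≟ d xs) (sym (product-filter (d ≟_) xs)) (m∣m*n _)

-- All entries equal to the head of `ds` are split off at once and the rest is treated recursively.
-- The bound `g` is left free: it becomes a `k`-th power in one application and a constant in the
-- other.
product≤∏-^multiplicity : ∀ (g : ℕ → ℕ) ds {xs} → List∀ NonZero ds → xs ⊆ ds →
                          List∀ (λ d → d ^ multiplicity d xs ≤ g d) ds → product xs ≤ product (List.map g ds)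
product≤∏-^multiplicity g []       {[]}     _ _    _ = ≤-refl
product≤∏-^multiplicity g []       {x ∷ xs} _ xs⊆  _ = case xs⊆ (here refl) of λ ()
product≤∏-^multiplicity g (d ∷ ds) {xs} (_ ∷ ds≢0) xs⊆ (d≤ ∷ ds≤) = begin
  product xs                                        ≡⟨ product-filter (d ≟_) xs ⟩
  product (filter (d ≟_) xs) * product rest         ≡⟨ cong (_* product rest) (product-filter≟ d xs) ⟩
  d ^ multiplicity d xs * product rest              ≤⟨ *-mono-≤ d≤ (product≤∏-^multiplicity g ds ds≢0 rest⊆ rest≤) ⟩
  g d * product (List.map g ds)                          ∎
  where
  open ≤-Reasoning
  rest = filter (¬? ∘ (d ≟_)) xs

  rest⊆ : rest ⊆ ds
  rest⊆ x∈ with ∈-filter⁻ (¬? ∘ (d ≟_)) {xs = xs} x∈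
  ... | x∈xs , d≢x with xs⊆ x∈xs
  ...   | here refl = contradiction refl d≢x
  ...   | there x∈ds = x∈ds

  -- Deleting entries can only lower multiplicities, and the powers of a nonzero `d′` increase with
  -- the exponent.
  rest≤ : List∀ (λ d′ → d′ ^ multiplicity d′ rest ≤ g d′) ds
  rest≤ = List∀.zipWith (λ {d′} (d′≢0 , d′≤) → ≤-trans
    (^-monoʳ-≤ d′ {{d′≢0}} (Sublist.length-mono-≤
      (Sublist.filter⁺ (d′ ≟_) (d′ ≟_) (λ { refl eq → eq }) (Sublist.filter-⊆ (¬? ∘ (d ≟_)) xs))))
    d′≤) (ds≢0 , ds≤)

product-map-^ : ∀ k xs → product (List.map (_^ k) xs) ≡ product xs ^ k
product-map-^ k []       = sym (^-zeroˡ k)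
product-map-^ k (x ∷ xs) = trans (cong (x ^ k *_) (product-map-^ k xs)) (sym (^-distribʳ-* x (product xs) k))

product-map-const : ∀ b (xs : List ℕ) → product (List.map (λ _ → b) xs) ≡ b ^ length xs
product-map-const b []       = refl
product-map-const b (x ∷ xs) = cong (b *_) (product-map-const b xs)

module DivisorOf[n!]^r (n r : ℕ) (x : ℕ) .{{_ : NonZero x}} (x∣ : x ∣ (n !) ^ r) where

  private
    open PrimeFactorisation (factorise x) using (isFactorisation; factorsPrime)
    ps = primeFactors x
    ds = deduplicate _≟_ ps

    ds⇒ps : ∀ {p} → p ∈ ds → p ∈ ps
    ds⇒ps = ∈-deduplicate⁻ _≟_ ps

    ds-prime : List∀ Prime ds
    ds-prime = List∀.tabulate (λ p∈ → List∀.lookup factorsPrime (ds⇒ps p∈))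

    ds≤n : List∀ (_≤ n) ds
    ds≤n = List∀.tabulate λ {p} p∈ →
      let pr = List∀.lookup ds-prime p∈ in
      prime∣!⇒≤ pr n (prime∣^⇒∣ pr (n !) r
        (∣-trans (subst (p ∣_) (sym isFactorisation) (∈⇒∣product (ds⇒ps p∈))) x∣))

    x≤ : ∀ g → (∀ {p} → p ∈ ds → p ^ exponent p x ≤ g p) → x ≤ product (List.map g ds)
    x≤ g h = subst (_≤ product (List.map g ds)) (sym isFactorisation)
      (product≤∏-^multiplicity g ds (List∀.map prime⇒nonZero ds-prime) (∈-deduplicate⁺ _≟_) (List∀.tabulate h))

  -- `x` is at most the `k`-th power of its radical, a product of distinct primes up to `n`.
  K<k⇒≤ : ∀ {k} → K x < k → x ≤ (16 ^ n) ^ k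
  K<k⇒≤ {k} K<k = begin
    x                        ≤⟨ x≤ (_^ k) exp≤ ⟩
    product (List.map (_^ k) ds)  ≡⟨ product-map-^ k ds ⟩
    product ds ^ k           ≤⟨ ^-monoˡ-≤ k (product-distinctPrimes≤16^n n (deduplicate-! _≟_ ps) ds-prime ds≤n) ⟩
    (16 ^ n) ^ k             ∎
    where
    open ≤-Reasoning
    exp≤ : ∀ {p} → p ∈ ds → p ^ exponent p x ≤ p ^ k
    exp≤ {p} p∈ = ^-monoʳ-≤ p {{prime⇒nonZero (List∀.lookup ds-prime p∈)}}
      (≤-trans (List∀.lookup (xs≤max 0 (List.map (λ p → exponent p x) ps)) (∈-map⁺ (λ p → exponent p x) (ds⇒ps p∈))) (<⇒≤ K<k))

  -- Each of the fewer than `l` prime powers that make up `x` divides (n!)^r, hence is at most `b`.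
  ω<l⇒≤ : ∀ {l} → ω x < l → x ≤ ((4 ^ n) ^ r) ^ l
  ω<l⇒≤ {l} ω<l = begin
    x                          ≤⟨ x≤ (λ _ → b) pp≤ ⟩
    product (List.map (λ _ → b) ds) ≡⟨ product-map-const b ds ⟩
    -- `length ds` is `ω x` by definition.
    b ^ length ds              ≤⟨ ^-monoʳ-≤ b {{m^n≢0 (4 ^ n) r {{m^n≢0 4 n}}}} (<⇒≤ ω<l) ⟩
    b ^ l                      ∎
    where
    open ≤-Reasoning
    b = (4 ^ n) ^ r
    pp≤ : ∀ {p} → p ∈ ds → p ^ exponent p x ≤ b
    pp≤ {p} p∈ = let pr = List∀.lookup ds-prime p∈ in
      primePowers-^ pr (primePowers∣n!≤4^n pr n) r (exponent p x)
        (∣-trans (subst (p ^ exponent p x ∣_) (sym isFactorisation) (^multiplicity∣product p ps)) x∣)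

𝓕𝓟-≤ : ∀ k l n r {x} → 𝓕𝓟 k l x → x ∣ (n !) ^ r → x ≤ (16 ^ n) ^ k * ((4 ^ n) ^ r) ^ l
𝓕𝓟-≤ k l n r (y , z , (y≢0 , Ky<k) , (z≢0 , ωz<l) , refl) yz∣ = *-mono-≤
  (DivisorOf[n!]^r.K<k⇒≤ n r y {{y≢0}} (m*n∣⇒m∣ y z yz∣) Ky<k)
  (DivisorOf[n!]^r.ω<l⇒≤ n r z {{z≢0}} (m*n∣⇒n∣ y z yz∣) ωz<l)

-- Exponentially bounded functions

-- The exponent is `suc n` so that the value at 0, too, can be absorbed into the base; with exponent
-- `n` it would have to be at most 1.
ExpBounded : (ℕ → ℕ) → Set
ExpBounded f = ∃[ c ] ∀ n → f n ≤ c ^ suc n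

expBounded-const : ∀ a → ExpBounded (λ _ → a)
expBounded-const a = suc a , λ n → ≤-trans (n≤1+n a) (m≤m*n (suc a) (suc a ^ n) {{m^n≢0 (suc a) n}})

expBounded-^n : ∀ a → ExpBounded (suc a ^_)
expBounded-^n a = suc a , λ n → ^-monoʳ-≤ (suc a) (n≤1+n n)

expBounded-* : ∀ {f g} → ExpBounded f → ExpBounded g → ExpBounded (λ n → f n * g n)
expBounded-* (c , f≤) (d , g≤) = c * d , λ n →
  ≤-trans (*-mono-≤ (f≤ n) (g≤ n)) (≤-reflexive (sym (^-distribʳ-* c d (suc n))))

expBounded-^ : ∀ {f} → ExpBounded f → ∀ d → ExpBounded (λ n → f n ^ d)
expBounded-^ f≤ zero    = expBounded-const 1
expBounded-^ f≤ (suc d) = expBounded-* f≤ (expBounded-^ f≤ d)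

expBounded-suc : ∀ {f} → ExpBounded f → ExpBounded (suc ∘ f)
expBounded-suc {f} (c , f≤) = suc c , λ n → begin
  suc (f n)                    ≤⟨ s≤s (f≤ n) ⟩
  1 + c * c ^ n                ≤⟨ +-mono-≤ (m^n>0 (suc c) n) (*-monoʳ-≤ c (^-monoˡ-≤ n (n≤1+n c))) ⟩
  suc c ^ n + c * suc c ^ n    ∎
  where open ≤-Reasoning

-- Growth of the double factorial

!!>0 : ∀ n → 0 < n !!
!!>0 zero          = z<s
!!>0 (suc zero)    = z<s
!!>0 (suc (suc n)) = *-mono-< {0} {suc (suc n)} z<s (!!>0 n)

-- Raising `d` by 2 multiplies the left side by exactly M^4, and the double factorial by a factor
-- that is at least M^4. The factor M^2 covers the starting case d = 1.
M^2d≤[d+M⁴]!!*M² : ∀ M .{{_ : NonZero M}} d → M ^ (d + d) ≤ (d + M ^ 4) !! * M ^ 2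
M^2d≤[d+M⁴]!!*M² M zero          = *-mono-≤ (!!>0 (M ^ 4)) (m^n>0 M 2)
M^2d≤[d+M⁴]!!*M² M (suc zero)    =
  m≤n*m (M ^ 2) ((1 + M ^ 4) !!) {{>-nonZero (!!>0 (1 + M ^ 4))}}
M^2d≤[d+M⁴]!!*M² M (suc (suc d)) = begin
  M ^ (2 + d + (2 + d))                          ≡⟨ cong (M ^_) 2d+4 ⟩
  M ^ (4 + (d + d))                              ≡⟨ ^-distribˡ-+-* M 4 (d + d) ⟩
  M ^ 4 * M ^ (d + d)                            ≤⟨ *-mono-≤ (m≤n+m (M ^ 4) (2 + d)) (M^2d≤[d+M⁴]!!*M² M d) ⟩
  (2 + d + M ^ 4) * ((d + M ^ 4) !! * M ^ 2)     ≡⟨ *-assoc (2 + d + M ^ 4) ((d + M ^ 4) !!) (M ^ 2) ⟨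
  (2 + d + M ^ 4) !! * M ^ 2                     ∎
  where
  open ≤-Reasoning
  2d+4 : 2 + d + (2 + d) ≡ 4 + (d + d)
  2d+4 = trans (cong (suc ∘ suc) (+-suc d (suc d))) (cong (suc ∘ suc ∘ suc) (+-suc d d))

-- Write n = d + T. If n!! ≤ c^(n+1), the previous lemma gives M^(2d) ≤ M^(d+T+3), hence d ≤ T + 3.
-- Values n ≤ T satisfy the bound anyway.
!!-notExpBounded : ∀ {f} → ExpBounded f → ∃[ L ] ∀ n → n !! ≤ f n → n ≤ L
!!-notExpBounded {f} (c , f≤) = 3 + T + T , bound
  where
  open ≤-Reasoning
  -- Large enough to dominate `c`, and at least 2, so that powers of `M` are strictly increasing.
  M = 2 + c
  T = M ^ 4

  d≤3+T : ∀ d → (d + T) !! ≤ f (d + T) → d ≤ 3 + T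
  d≤3+T d !!≤f = ≮⇒≥ λ 3+T<d → <⇒≱ (^-monoʳ-< M (s≤s (s≤s z≤n)) (+-monoʳ-< d 3+T<d)) (begin
    M ^ (d + d)                   ≤⟨ M^2d≤[d+M⁴]!!*M² M d ⟩
    (d + T) !! * M ^ 2            ≤⟨ *-monoˡ-≤ (M ^ 2) (≤-trans !!≤f (f≤ (d + T))) ⟩
    c ^ suc (d + T) * M ^ 2       ≤⟨ *-monoˡ-≤ (M ^ 2) (^-monoˡ-≤ (suc (d + T)) (m≤n+m c 2)) ⟩
    M ^ suc (d + T) * M ^ 2       ≡⟨ ^-distribˡ-+-* M (suc (d + T)) 2 ⟨
    M ^ (suc (d + T) + 2)         ≡⟨ cong (M ^_) eq ⟩
    M ^ (d + (3 + T))             ∎)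
    where
    eq : suc (d + T) + 2 ≡ d + (3 + T)
    eq = trans (cong (_+ 2) (sym (+-suc d T))) (trans (+-assoc d (suc T) 2) (cong (λ t → d + t) (+-comm (suc T) 2)))

  bound : ∀ n → n !! ≤ f n → n ≤ 3 + T + T
  bound n n!!≤f with ≤-total n T
  ... | inj₁ n≤T = ≤-trans n≤T (m≤n+m T (3 + T))
  ... | inj₂ T≤n = subst (_≤ 3 + T + T) (m∸n+n≡m T≤n)
    (+-monoˡ-≤ T (d≤3+T (n ∸ T) (subst (λ k → k !! ≤ f k) (sym (m∸n+n≡m T≤n)) n!!≤f)))

-- Evaluation of polynomials

⟦⟧-+ : ∀ p q x → ⟦ p +ᵖ q ⟧ x ≡ ⟦ p ⟧ x ℤ.+ ⟦ q ⟧ x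
⟦⟧-+ []      q       x = sym (ℤ.+-identityˡ _)
⟦⟧-+ (c ∷ p) []      x = sym (ℤ.+-identityʳ _)
⟦⟧-+ (c ∷ p) (d ∷ q) x = trans (cong (λ t → c ℤ.+ d ℤ.+ x ℤ.* t) (⟦⟧-+ p q x)) (rearrange c d x _ _)
  where
  rearrange : ∀ c d x s t → c ℤ.+ d ℤ.+ x ℤ.* (s ℤ.+ t) ≡ (c ℤ.+ x ℤ.* s) ℤ.+ (d ℤ.+ x ℤ.* t)
  rearrange = ℤ-Solver.solve-∀

⟦⟧-scale : ∀ c p x → ⟦ List.map (c ℤ.*_) p ⟧ x ≡ c ℤ.* ⟦ p ⟧ x
⟦⟧-scale c []      x = sym (ℤ.*-zeroʳ c)
⟦⟧-scale c (d ∷ p) x = trans (cong (λ t → c ℤ.* d ℤ.+ x ℤ.* t) (⟦⟧-scale c p x)) (rearrange c d x _)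
  where
  rearrange : ∀ c d x s → c ℤ.* d ℤ.+ x ℤ.* (c ℤ.* s) ≡ c ℤ.* (d ℤ.+ x ℤ.* s)
  rearrange = ℤ-Solver.solve-∀

⟦⟧-* : ∀ p q x → ⟦ p *ᵖ q ⟧ x ≡ ⟦ p ⟧ x ℤ.* ⟦ q ⟧ x
⟦⟧-* []      q x = refl
⟦⟧-* (c ∷ p) q x = begin
  ⟦ List.map (c ℤ.*_) q +ᵖ (ℤ.0ℤ ∷ p *ᵖ q) ⟧ x                ≡⟨ ⟦⟧-+ (List.map (c ℤ.*_) q) _ x ⟩
  ⟦ List.map (c ℤ.*_) q ⟧ x ℤ.+ (ℤ.0ℤ ℤ.+ x ℤ.* ⟦ p *ᵖ q ⟧ x)  ≡⟨ cong₂ (λ s t → s ℤ.+ (ℤ.0ℤ ℤ.+ x ℤ.* t)) (⟦⟧-scale c q x) (⟦⟧-* p q x) ⟩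
  c ℤ.* ⟦ q ⟧ x ℤ.+ (ℤ.0ℤ ℤ.+ x ℤ.* (⟦ p ⟧ x ℤ.* ⟦ q ⟧ x))    ≡⟨ rearrange c x _ _ ⟩
  (c ℤ.+ x ℤ.* ⟦ p ⟧ x) ℤ.* ⟦ q ⟧ x                          ∎
  where
  open ≡-Reasoning
  rearrange : ∀ c x s t → c ℤ.* t ℤ.+ (ℤ.0ℤ ℤ.+ x ℤ.* (s ℤ.* t)) ≡ (c ℤ.+ x ℤ.* s) ℤ.* t
  rearrange = ℤ-Solver.solve-∀

⟦⟧-zero : ∀ p x → p ≈ᵖ [] → ⟦ p ⟧ x ≡ ℤ.0ℤ
⟦⟧-zero []      x _   = refl
⟦⟧-zero (c ∷ p) x p≈0 rewrite p≈0 0 | ⟦⟧-zero p x (p≈0 ∘ suc) = trans (ℤ.+-identityˡ _) (ℤ.*-zeroʳ x)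

-- Equal polynomials may be lists of different lengths; the excess coefficients vanish, which is the
-- case of `⟦⟧-zero`.
⟦⟧-cong : ∀ p q x → p ≈ᵖ q → ⟦ p ⟧ x ≡ ⟦ q ⟧ x
⟦⟧-cong []      q       x p≈q = sym (⟦⟧-zero q x (sym ∘ p≈q))
⟦⟧-cong (c ∷ p) []      x p≈q = ⟦⟧-zero (c ∷ p) x p≈q
⟦⟧-cong (c ∷ p) (d ∷ q) x p≈q = cong₂ (λ s t → s ℤ.+ x ℤ.* t) (p≈q 0) (⟦⟧-cong p q x (p≈q ∘ suc))

-- Since e ≥ 1, a factor X - a can be split off, and its value at y + a is y. Elements of `S` come
-- in the form y + a.
X-a∣⇒y∣⟦⟧[y+a] : ∀ P {a} e Q → 1 ≤ e → P ≈ᵖ ((X- a) ^ᵖ e) *ᵖ Q → ∀ y → ∣ y ∣ ∣ ∣ ⟦ P ⟧ (y ℤ.+ a) ∣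
X-a∣⇒y∣⟦⟧[y+a] P {a} (suc e) Q _ P≈ y = subst (∣ y ∣ ∣_) (sym eq) (∣m⇒∣m*n _ (m∣m*n _))
  where
  open ≡-Reasoning
  x = y ℤ.+ a
  L = (X- a) ^ᵖ e
  ⟦X-a⟧ : ∀ a y → (ℤ.- a) ℤ.+ (y ℤ.+ a) ℤ.* (ℤ.1ℤ ℤ.+ (y ℤ.+ a) ℤ.* ℤ.0ℤ) ≡ y
  ⟦X-a⟧ = ℤ-Solver.solve-∀
  eq : ∣ ⟦ P ⟧ x ∣ ≡ ∣ y ∣ * ∣ ⟦ L ⟧ x ∣ * ∣ ⟦ Q ⟧ x ∣
  eq = begin
    ∣ ⟦ P ⟧ x ∣                                       ≡⟨ cong ∣_∣ (⟦⟧-cong P (((X- a) *ᵖ L) *ᵖ Q) x P≈) ⟩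
    ∣ ⟦ ((X- a) *ᵖ L) *ᵖ Q ⟧ x ∣                      ≡⟨ cong ∣_∣ (⟦⟧-* ((X- a) *ᵖ L) Q x) ⟩
    ∣ ⟦ (X- a) *ᵖ L ⟧ x ℤ.* ⟦ Q ⟧ x ∣                 ≡⟨ ℤ.abs-* (⟦ (X- a) *ᵖ L ⟧ x) _ ⟩
    ∣ ⟦ (X- a) *ᵖ L ⟧ x ∣ * ∣ ⟦ Q ⟧ x ∣               ≡⟨ cong (λ t → ∣ t ∣ * ∣ ⟦ Q ⟧ x ∣) (⟦⟧-* (X- a) L x) ⟩
    ∣ ⟦ X- a ⟧ x ℤ.* ⟦ L ⟧ x ∣ * ∣ ⟦ Q ⟧ x ∣          ≡⟨ cong (λ t → ∣ t ℤ.* ⟦ L ⟧ x ∣ * ∣ ⟦ Q ⟧ x ∣) (⟦X-a⟧ a y) ⟩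
    ∣ y ℤ.* ⟦ L ⟧ x ∣ * ∣ ⟦ Q ⟧ x ∣                   ≡⟨ cong (_* ∣ ⟦ Q ⟧ x ∣) (ℤ.abs-* y _) ⟩
    ∣ y ∣ * ∣ ⟦ L ⟧ x ∣ * ∣ ⟦ Q ⟧ x ∣                 ∎

-- Unlike ∣_∣, this is submultiplicative with respect to both + and *.
∥_∥ : ℤ → ℕ
∥ x ∥ = suc ∣ x ∣

∥x+y∥≤ : ∀ x y → ∥ x ℤ.+ y ∥ ≤ ∥ x ∥ * ∥ y ∥
∥x+y∥≤ x y = s≤s (begin
  ∣ x ℤ.+ y ∣              ≤⟨ ℤ.∣i+j∣≤∣i∣+∣j∣ x y ⟩
  ∣ x ∣ + ∣ y ∣            ≡⟨ +-comm ∣ x ∣ ∣ y ∣ ⟩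
  ∣ y ∣ + ∣ x ∣            ≤⟨ +-monoʳ-≤ ∣ y ∣ (m≤m*n ∣ x ∣ ∥ y ∥) ⟩
  ∣ y ∣ + ∣ x ∣ * ∥ y ∥    ∎)
  where open ≤-Reasoning

∥x*y∥≤ : ∀ x y → ∥ x ℤ.* y ∥ ≤ ∥ x ∥ * ∥ y ∥
∥x*y∥≤ x y = s≤s (begin
  ∣ x ℤ.* y ∣              ≡⟨ ℤ.abs-* x y ⟩
  ∣ x ∣ * ∣ y ∣            ≤⟨ *-monoʳ-≤ ∣ x ∣ (n≤1+n ∣ y ∣) ⟩
  ∣ x ∣ * ∥ y ∥            ≤⟨ m≤n+m _ ∣ y ∣ ⟩
  ∣ y ∣ + ∣ x ∣ * ∥ y ∥    ∎)
  where open ≤-Reasoning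

-- Along Horner's scheme, each coefficient `c` contributes the factors `∥ c ∥` and `∥ x ∥`.
∥⟦p⟧∥≤ : ∀ p x → ∥ ⟦ p ⟧ x ∥ ≤ product (List.map ∥_∥ p) * ∥ x ∥ ^ length p
∥⟦p⟧∥≤ []      x = ≤-refl
∥⟦p⟧∥≤ (c ∷ p) x = begin
  ∥ c ℤ.+ x ℤ.* ⟦ p ⟧ x ∥               ≤⟨ ∥x+y∥≤ c _ ⟩
  ∥ c ∥ * ∥ x ℤ.* ⟦ p ⟧ x ∥             ≤⟨ *-monoʳ-≤ ∥ c ∥ (∥x*y∥≤ x _) ⟩
  ∥ c ∥ * (∥ x ∥ * ∥ ⟦ p ⟧ x ∥)         ≤⟨ *-monoʳ-≤ ∥ c ∥ (*-monoʳ-≤ ∥ x ∥ (∥⟦p⟧∥≤ p x)) ⟩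
  ∥ c ∥ * (∥ x ∥ * (A * B))             ≡⟨ cong (∥ c ∥ *_) (x∙yz≈y∙xz *-commutativeSemigroup ∥ x ∥ A B) ⟩
  ∥ c ∥ * (A * (∥ x ∥ * B))             ≡⟨ *-assoc ∥ c ∥ A _ ⟨
  ∥ c ∥ * A * (∥ x ∥ * B)               ∎
  where
  open ≤-Reasoning
  A = product (List.map ∥_∥ p)
  B = ∥ x ∥ ^ length p

-- The factor 2 is `∥ 1 ∥`, the value at n = 0.
∥x^n∥≤ : ∀ {x b} → ∥ x ∥ ≤ b → ∀ n → ∥ x ℤ.^ n ∥ ≤ 2 * b ^ n
∥x^n∥≤         _   zero    = ≤-refl
∥x^n∥≤ {x} {b} x≤b (suc n) = begin
  ∥ x ℤ.* x ℤ.^ n ∥        ≤⟨ ∥x*y∥≤ x (x ℤ.^ n) ⟩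
  ∥ x ∥ * ∥ x ℤ.^ n ∥      ≤⟨ *-mono-≤ x≤b (∥x^n∥≤ x≤b n) ⟩
  b * (2 * b ^ n)          ≡⟨ x∙yz≈y∙xz *-commutativeSemigroup b 2 (b ^ n) ⟩
  2 * (b * b ^ n)          ∎
  where open ≤-Reasoning

-- Polynomial growth in several variables

PolyBounded : ∀ {m} → (Vec ℤ m → ℤ) → Set
PolyBounded f = ∃[ c ] ∃[ d ] ∀ {b xs} → All (λ x → ∥ x ∥ ≤ b) xs → ∥ f xs ∥ ≤ c * b ^ d

*-polyBound : ∀ {s t} b c d c′ d′ → s ≤ c * b ^ d → t ≤ c′ * b ^ d′ → s * t ≤ c * c′ * b ^ (d + d′)
*-polyBound {s} {t} b c d c′ d′ s≤ t≤ = begin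
  s * t                             ≤⟨ *-mono-≤ s≤ t≤ ⟩
  c * b ^ d * (c′ * b ^ d′)         ≡⟨ [m*n]*[o*p]≡[m*o]*[n*p] c (b ^ d) c′ (b ^ d′) ⟩
  c * c′ * (b ^ d * b ^ d′)         ≡⟨ cong (c * c′ *_) (^-distribˡ-+-* b d d′) ⟨
  c * c′ * b ^ (d + d′)             ∎
  where open ≤-Reasoning

monomial-polyBounded : ∀ {m} (α : Vec ℕ m) → PolyBounded (λ xs → Vec.foldr _ ℤ._*_ ℤ.1ℤ (Vec.zipWith ℤ._^_ xs α))
monomial-polyBounded []      = 2 , 0 , λ { [] → ≤-refl }
monomial-polyBounded (n ∷ α) with monomial-polyBounded α
... | c , d , ih = 2 * c , n + d , λ { {b} {x ∷ xs} (x≤b ∷ xs≤b) →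
  ≤-trans (∥x*y∥≤ (x ℤ.^ n) _) (*-polyBound b 2 n c d (∥x^n∥≤ {x} x≤b n) (ih xs≤b)) }

⟦⟧ᵐ-polyBounded : ∀ {m} (R : MvPoly m) → PolyBounded ⟦ R ⟧ᵐ
⟦⟧ᵐ-polyBounded []            = 1 , 0 , λ _ → ≤-refl
⟦⟧ᵐ-polyBounded ((a , α) ∷ R) with monomial-polyBounded α | ⟦⟧ᵐ-polyBounded R
... | c , d , ihα | c′ , d′ , ihR = ∥ a ∥ * c * c′ , d + d′ , λ {b} xs≤b →
  ≤-trans (∥x+y∥≤ (a ℤ.* _) _) (*-polyBound b (∥ a ∥ * c) d c′ d′
    (≤-trans (∥x*y∥≤ a _) (≤-trans (*-monoʳ-≤ ∥ a ∥ (ihα xs≤b)) (≤-reflexive (sym (*-assoc ∥ a ∥ c (b ^ d))))))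
    (ihR xs≤b))

-- The successor of a product is at most the product of the successors; the 2 comes from the empty
-- product.
suc-product≤ : ∀ {m b} {xs : Vec ℕ m} → All (λ x → suc x ≤ b) xs → suc (product (toList xs)) ≤ 2 * b ^ m
suc-product≤ []                                     = ≤-refl
suc-product≤ {suc m} {b} {x ∷ xs} (x<b ∷ xs<b) = begin
  suc (x * product (toList xs))          ≤⟨ s≤s (≤-trans (*-monoʳ-≤ x (n≤1+n Π)) (m≤n+m _ Π)) ⟩
  suc x * suc Π                          ≤⟨ *-mono-≤ x<b (suc-product≤ xs<b) ⟩
  b * (2 * b ^ m)                        ≡⟨ x∙yz≈y∙xz *-commutativeSemigroup b 2 (b ^ m) ⟩
  2 * (b * b ^ m)                        ∎
  where
  open ≤-Reasoning
  Π = product (toList xs)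

-- Divisibility and size of the right-hand side

n!!∣n! : ∀ n → n !! ∣ n !
n!!∣n! zero          = ∣-refl
n!!∣n! (suc zero)    = ∣-refl
n!!∣n! (suc (suc n)) = *-monoʳ-∣ (suc (suc n)) (∣n⇒∣m*n (suc n) (n!!∣n! n))

product-map∣^length : ∀ {f : ℕ → ℕ} {b ns} → List∀ (λ n → f n ∣ b) ns → product (List.map f ns) ∣ b ^ length ns
product-map∣^length []         = ∣-refl
product-map∣^length (fn∣ ∷ f∣) = *-pres-∣ fn∣ (product-map∣^length f∣)

-- Each of the `r` factors divides `n !`, the double factorials by way of `n!!∣n!`.
factorials∣[n!]^r : ∀ s {r n} (ns : Vec ℕ r) → List∀ (_≤ n) (toList ns) → factorials s ns ∣ (n !) ^ r
factorials∣[n!]^r s {r} {n} ns ns≤n = subst (factorials s ns ∣_) eq (*-pres-∣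
  (product-map∣^length (List∀.map m≤n⇒m!∣n! (List∀.take⁺ s ns≤n)))
  (product-map∣^length (List∀.map (λ {i} i≤n → ∣-trans (n!!∣n! i) (m≤n⇒m!∣n! i≤n)) (List∀.drop⁺ s ns≤n))))
  where
  open ≡-Reasoning
  xs = toList ns
  eq : (n !) ^ length (take s xs) * (n !) ^ length (drop s xs) ≡ (n !) ^ r
  eq = begin
    (n !) ^ length (take s xs) * (n !) ^ length (drop s xs)   ≡⟨ ^-distribˡ-+-* (n !) (length (take s xs)) _ ⟨
    (n !) ^ (length (take s xs) + length (drop s xs))         ≡⟨ cong ((n !) ^_) (length-++ (take s xs)) ⟨
    (n !) ^ length (take s xs ++ drop s xs)                   ≡⟨ cong (λ ys → (n !) ^ length ys) (take++drop≡id s xs) ⟩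
    (n !) ^ length xs                                         ≡⟨ cong ((n !) ^_) (length-toList ns) ⟩
    (n !) ^ r                                                 ∎

factorials≢0 : ∀ s {r} (ns : Vec ℕ r) → NonZero (factorials s ns)
factorials≢0 s ns = m*n≢0 _ _
  {{product≢0 (List∀.map⁺ (List∀.universal _!≢0 (take s (toList ns))))}}
  {{product≢0 (List∀.map⁺ (List∀.universal (>-nonZero ∘ !!>0) (drop s (toList ns))))}}

-- Whether `n` enters through n! or n!!, its factor is a multiple of n!!.
∈⇒!!≤factorials : ∀ s {r n} (ns : Vec ℕ r) → n ∈ toList ns → n !! ≤ factorials s ns
∈⇒!!≤factorials s {n = n} ns n∈ = ∣⇒≤ {{factorials≢0 s ns}} n!!∣
  where
  n!!∣ : n !! ∣ factorials s ns
  n!!∣ with ∈-++⁻ (take s (toList ns)) (subst (n ∈_) (sym (take++drop≡id s (toList ns))) n∈)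
  ... | inj₁ n∈take = ∣m⇒∣m*n _ (∣-trans (n!!∣n! n) (∈⇒∣product (∈-map⁺ _! n∈take)))
  ... | inj₂ n∈drop = ∣n⇒∣m*n (product (List.map _! (take s (toList ns)))) (∈⇒∣product (∈-map⁺ _!! n∈drop))

max!!≤factorials : ∀ s {r} (ns : Vec ℕ r) → max 0 (toList ns) !! ≤ factorials s ns
max!!≤factorials s ns with argmax-sel (λ n → n) 0 (toList ns)
-- If the maximum is the default 0, the claim is 0!! = 1 ≤ N.
... | inj₁ max≡0 = subst (λ n → n !! ≤ factorials s ns) (sym max≡0) (>-nonZero⁻¹ _ {{factorials≢0 s ns}})
... | inj₂ max∈  = ∈⇒!!≤factorials s ns max∈

-- Finite boxes of candidate solutions

vectorsUpTo : ∀ r → ℕ → List (Vec ℕ r)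
vectorsUpTo zero    L = [] ∷ []
vectorsUpTo (suc r) L = cartesianProductWith _∷_ (upTo (suc L)) (vectorsUpTo r L)

∈-vectorsUpTo : ∀ {r L} (ns : Vec ℕ r) → List∀ (_≤ L) (toList ns) → ns ∈ vectorsUpTo r L
∈-vectorsUpTo []       []           = here refl
∈-vectorsUpTo (n ∷ ns) (n≤L ∷ ns≤L) = ∈-cartesianProductWith⁺ _∷_ (∈-upTo⁺ (s≤s n≤L)) (∈-vectorsUpTo ns ns≤L)

integersBelow : ℕ → List ℤ
integersBelow b = List.map +_ (upTo b) ++ List.map -[1+_] (upTo b)

∈-integersBelow : ∀ {b} x → ∣ x ∣ < b → x ∈ integersBelow b
∈-integersBelow (+ n)      n<b = ∈-++⁺ˡ (∈-map⁺ +_ (∈-upTo⁺ n<b))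
∈-integersBelow -[1+ n ] 1+n<b = ∈-++⁺ʳ (List.map +_ (upTo _)) (∈-map⁺ -[1+_] (∈-upTo⁺ (<-trans (n<1+n n) 1+n<b)))

-- Size of the elements of `S`, and finiteness of the solutions

All-∣-product : ∀ {m ℓ} {Q : Pred ℕ ℓ} {b} {xs : Vec ℕ m} → All Q xs → product (toList xs) ∣ b → All (λ x → Q x × x ∣ b) xs
All-∣-product                []         _  = []
All-∣-product {xs = x ∷ xs} (qx ∷ qxs) Π∣b =
  (qx , m*n∣⇒m∣ x _ Π∣b) ∷ All-∣-product qxs (m*n∣⇒n∣ x _ Π∣b)

S-expBound : ∀ k l r {m} a (R : MvPoly m) → ∃[ f ] (ExpBounded f ×
  (∀ n {xs : Vec ℕ m} → All (𝓕𝓟 k l) xs → product (toList xs) ∣ (n !) ^ r →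
    ∥ + product (toList xs) ℤ.* ⟦ R ⟧ᵐ (Vec.map +_ xs) ℤ.+ a ∥ ≤ f n))
S-expBound k l r {m} a R with ⟦⟧ᵐ-polyBounded R
... | c , d , R≤ = f , f-exp , bound
  where
  b f : ℕ → ℕ
  -- The successor makes `b n` a bound for `∥ + x ∥` = x + 1 rather than for x.
  b n = suc ((16 ^ n) ^ k * ((4 ^ n) ^ r) ^ l)
  f n = 2 * b n ^ m * (c * b n ^ d) * ∥ a ∥

  b-exp : ExpBounded b
  -- `expBounded-^n` takes the predecessor of the base: 15 and 3 stand for 16 and 4.
  b-exp = expBounded-suc (expBounded-* (expBounded-^ (expBounded-^n 15) k)
                                       (expBounded-^ (expBounded-^ (expBounded-^n 3) r) l))
  f-exp : ExpBounded f
  f-exp = expBounded-* (expBounded-* (expBounded-* (expBounded-const 2) (expBounded-^ b-exp m))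
                                     (expBounded-* (expBounded-const c) (expBounded-^ b-exp d)))
                       (expBounded-const ∥ a ∥)

  bound : ∀ n {xs : Vec ℕ m} → All (𝓕𝓟 k l) xs → product (toList xs) ∣ (n !) ^ r →
          ∥ + product (toList xs) ℤ.* ⟦ R ⟧ᵐ (Vec.map +_ xs) ℤ.+ a ∥ ≤ f n
  bound n {xs} xs∈ Π∣ = ≤-trans (∥x+y∥≤ (+ product (toList xs) ℤ.* _) a) (*-monoˡ-≤ ∥ a ∥
    (≤-trans (∥x*y∥≤ (+ product (toList xs)) _) (*-mono-≤ (suc-product≤ xs<b) (R≤ (Vec∀.map⁺ xs<b)))))
    where
    xs<b : All (λ x → suc x ≤ b n) xs
    xs<b = Vec∀.map (λ (x∈ , x∣) → s≤s (𝓕𝓟-≤ k l n r x∈ x∣)) (All-∣-product xs∈ Π∣)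

theorem5 : (k l m : ℕ) → 2 ≤ k → 2 ≤ l → 1 ≤ m →
    (a : ℤ) (R : MvPoly m) →
    (s r : ℕ) → s ≤ r → 1 ≤ r →
    (P : Poly) (e t : ℕ) (Pⱼ : Fin t → Poly) (eⱼ : Fin t → ℕ) →
    1 ≤ e → (∀ j → 1 ≤ eⱼ j) →
    (∀ j → Irreducible (Pⱼ j)) →
    (∀ i j → i ≢ j → ¬ (Pⱼ i ≈ᵖ Pⱼ j)) →
    P ≈ᵖ ((X- a) ^ᵖ e) *ᵖ ∏ᵖ (λ j → Pⱼ j ^ᵖ eⱼ j) →
    Finite {Vec ℕ r × ℤ} (λ (ns , x) →
    All (1 ≤_) ns × S k l a R x × ⟦ P ⟧ x ≡ + factorials s ns)
theorem5 k l m _ _ _ a R s r _ _ P e t Pⱼ eⱼ 1≤e _ _ _ P≈ =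
  cartesianProduct (vectorsUpTo r L) (integersBelow (c ^ suc L)) , solution∈
  where
  f = proj₁ (S-expBound k l r a R)
  f-exp = proj₁ (proj₂ (S-expBound k l r a R))
  ∥x∥≤f = proj₂ (proj₂ (S-expBound k l r a R))
  -- The successor makes `c` nonzero, so `c ^ suc n` grows with n and `c ^ suc L` serves for every n
  -- ≤ L.
  c = suc (proj₁ f-exp)

  g : ℕ → ℕ
  g n = product (List.map ∥_∥ P) * f n ^ length P

  g-exp : ExpBounded g
  g-exp = expBounded-* (expBounded-const (product (List.map ∥_∥ P))) (expBounded-^ f-exp (length P))

  L = proj₁ (!!-notExpBounded g-exp)

  solution∈ : ∀ {(ns , x) : Vec ℕ r × ℤ} → All (1 ≤_) ns × S k l a R x × ⟦ P ⟧ x ≡ + factorials s ns →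
              (ns , x) ∈ cartesianProduct (vectorsUpTo r L) (integersBelow (c ^ suc L))
  solution∈ {ns , x} (_ , (xs , xs∈ , refl) , P[x]≡N) = ∈-cartesianProduct⁺
    (∈-vectorsUpTo ns (List∀.map (λ i≤n → ≤-trans i≤n n≤L) ns≤n))
    -- A strict bound on `∣ x ∣` is by definition a weak bound on `∥ x ∥`.
    (∈-integersBelow x (begin
      ∥ x ∥                ≤⟨ x≤f ⟩
      f n                  ≤⟨ proj₂ f-exp n ⟩
      proj₁ f-exp ^ suc n  ≤⟨ ^-monoˡ-≤ (suc n) (n≤1+n (proj₁ f-exp)) ⟩
      c ^ suc n            ≤⟨ ^-monoʳ-≤ c (s≤s n≤L) ⟩
      c ^ suc L            ∎))
    where
    open ≤-Reasoning
    n = max 0 (toList ns)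
    Π = product (toList xs)
    y = + Π ℤ.* ⟦ R ⟧ᵐ (Vec.map +_ xs)

    ns≤n : List∀ (_≤ n) (toList ns)
    ns≤n = xs≤max 0 (toList ns)

    y∣N : ∣ y ∣ ∣ factorials s ns
    y∣N = subst (∣ y ∣ ∣_) (cong ∣_∣ P[x]≡N) (X-a∣⇒y∣⟦⟧[y+a] P e (∏ᵖ (λ j → Pⱼ j ^ᵖ eⱼ j)) 1≤e P≈ y)

    Π∣ : Π ∣ (n !) ^ r
    Π∣ = ∣-trans (subst (Π ∣_) (sym (ℤ.abs-* (+ Π) _)) (m∣m*n _))
                 (∣-trans y∣N (factorials∣[n!]^r s ns ns≤n))

    x≤f : ∥ x ∥ ≤ f n
    x≤f = ∥x∥≤f n xs∈ Π∣

    n≤L : n ≤ L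
    -- The two estimates of N meet: n!! ≤ N = |P(x)| ≤ `g n`, with `g` exponentially bounded.
    n≤L = proj₂ (!!-notExpBounded g-exp) n (begin
      n !!                                             ≤⟨ max!!≤factorials s ns ⟩
      factorials s ns                                  ≡⟨ cong ∣_∣ P[x]≡N ⟨
      ∣ ⟦ P ⟧ x ∣                                      ≤⟨ n≤1+n _ ⟩
      ∥ ⟦ P ⟧ x ∥                                      ≤⟨ ∥⟦p⟧∥≤ P x ⟩
      product (List.map ∥_∥ P) * ∥ x ∥ ^ length P      ≤⟨ *-monoʳ-≤ (product (List.map ∥_∥ P)) (^-monoˡ-≤ (length P) x≤f) ⟩
      g n                                              ∎)
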